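{- We have $\mathbb{S}(1,1;\alpha,\beta,\lambda,\mu)=1$, and for all integers $n\ge 2$ and $1\le m\le n$, $$\mathbb{S}(n,m;\alpha,\beta,\lambda,\mu)=(\alpha+(m-1)\beta)\,\mathbb{S}(n-1,m-1;\alpha,\beta,\lambda,\mu)+(m\lambda+(n-1)\mu)\,\mathbb{S}(n-1,m;\alpha,\beta,\lambda,\mu).$$
   Context: $\mathrm{LLP}_{n,m}$ is the set of all "list of lists" partitions of $[n]=\{1,\dots,n\}$ into $m$ blocks: ordered sequences $\pi=B_1/B_2/\cdots/B_m$ of nonempty disjoint blocks with union $[n]$, where in addition the elements inside each block are linearly ordered (each block is a word $B_\ell=\sigma_1\cdots\sigma_{n_\ell}$). For $\pi\in\mathrm{LLP}_{n,m}$ define four statistics. (1) $\mathrm{rlb}(\pi)$ is the number of indices $j$ such that $\min B_j<\min B_l$ for all $l>j$ and $\min B_j>1$. (2) $\mathrm{nsb}(\pi)$ is the number of blocks that must be moved to the right to make the sequence of block minima increasing, i.e. the number of indices $j$ for which there is $l>j$ with $\min B_l<\min B_j$; thus $\mathrm{nsb}(\pi)+\mathrm{rlb}(\pi)=m-1$. (3) For a block $B_\ell=\sigma_1\cdots\sigma_{n_\ell}$, $\mathrm{rle}(B_\ell)$ is the number of indices $j$ such that $\sigma_j<\sigma_l$ for all $l>j$ and $\sigma_j>\min B_\ell$; and $\mathrm{rle}(\pi)=\sum_{\ell}\mathrm{rle}(B_\ell)$. (4) $\mathrm{nse}(\pi)$ is the total number of elements that must be moved to the right inside their blocks to make every block increasing,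 i.e. the number of elements that are followed, somewhere later in the same block, by a smaller element; thus $\mathrm{nse}(\pi)+\mathrm{rle}(\pi)=n-m$. For integers $1\le m\le n$ define $$\mathbb{S}(n,m;\alpha,\beta,\lambda,\mu)=\sum_{\pi\in\mathrm{LLP}_{n,m}}\alpha^{\mathrm{rlb}(\pi)}\beta^{\mathrm{nsb}(\pi)}\lambda^{\mathrm{rle}(\pi)}\mu^{\mathrm{nse}(\pi)},$$ a polynomial in the indeterminates $\alpha,\beta,\lambda,\mu$; set $\mathbb{S}(n,m;\alpha,\beta,\lambda,\mu)=0$ for all other $(n,m)$. -}

module Defs where

open import Algebra.Bundles using (CommutativeRing)
open import Data.Bool.Base using (if_then_else_)
open import Data.Fin.Base using (Fin)
open import Data.Fin.Properties using (injective⇒≤)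
open import Data.List.Base
  using (List; []; _∷_; [_]; map; concatMap; filter; foldr; length; lookup; upTo; cartesianProductWith)
open import Data.List.NonEmpty.Base as List⁺ using (List⁺; _∷_; toList)
open import Data.List.Membership.Propositional using (_∈_)
open import Data.List.Membership.Propositional.Properties
  using (∈-cartesianProductWith⁺; ∈-cartesianProductWith⁻; ∈-filter⁺; ∈-filter⁻; ∈-lookup; ∈-++⁺ˡ; ∈-++⁺ʳ)
open import Data.List.Properties using (length-map; length-upTo)
open import Data.List.Relation.Binary.Disjoint.Propositional using (Disjoint)
open import Data.List.Relation.Binary.Subset.Propositional using (_⊆_)
open import Data.List.Relation.Unary.All as All using (All; []; _∷_; all?)
open import Data.List.Relation.Unary.AllPairs using (AllPairs; []; _∷_; allPairs?)
open import Data.List.Relation.Unary.Any as Any using (here; there; any?)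
open import Data.List.Relation.Unary.Any.Properties using (lookup-index)
open import Data.List.Relation.Unary.Unique.Propositional using (Unique)
open import Data.List.Relation.Unary.Unique.Propositional.Properties
  using (map⁺; upTo⁺; filter⁺; cartesianProductWith⁺)
open import Data.Nat.Base
  using (ℕ; zero; suc; pred; _+_; _⊓_; _≤_; z≤n; s≤s)
open import Data.Nat.ListAction using (sum)
open import Data.Nat.Properties as ℕ using (_≟_; _≤?_; _<?_; suc-injective)
open import Data.Product.Base using (_×_; _,_; proj₂)
open import Function.Base using (_∘_)
open import Function.Bundles using (_⇔_; mk⇔)
open import Relation.Binary.PropositionalEquality
  using (_≡_; refl; sym; trans; cong; subst)
open import Relation.Nullary using (does; contradiction)
open import Relation.Nullary.Decidable using (map′; _×-dec_)
open import Relation.Unary using (Pred; Decidable)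

open import Data.List.Relation.Unary.Unique.DecPropositional _≟_ using (unique?)
open import Data.List.Relation.Binary.Disjoint.DecPropositional _≟_ using (disjoint?)
open import Data.List.Relation.Binary.Subset.DecPropositional _≟_ using (_⊆?_)

[1⋯_] : ℕ → List ℕ
[1⋯ n ] = map suc (upTo n)

-- The order of the letters of a block is its linear order.
Block : Set
Block = List⁺ ℕ

minB : Block → ℕ
minB = List⁺.foldr₁ _⊓_

record IsLLP (n m : ℕ) (π : List Block) : Set where
  field
    #blocks  : length π ≡ m
    linear   : All Unique (map toList π)
    disjoint : AllPairs Disjoint (map toList π)
    union⊆   : concatMap toList π ⊆ [1⋯ n ]
    union⊇   : [1⋯ n ] ⊆ concatMap toList π

isLLP? : ∀ n m → Decidable (IsLLP n m)
isLLP? n m π = map′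
  (λ (a , b , c , d , e) → record
    { #blocks = a ; linear = b ; disjoint = c ; union⊆ = λ {x} → d {x} ; union⊇ = λ {x} → e {x} })
  (λ p → let open IsLLP p in #blocks , linear , disjoint , (λ {x} → union⊆ {x}) , (λ {x} → union⊇ {x}))
  (length π ≟ m ×-dec all? unique? (map toList π) ×-dec
   allPairs? disjoint? (map toList π) ×-dec
   (concatMap toList π ⊆? [1⋯ n ]) ×-dec ([1⋯ n ] ⊆? concatMap toList π))

module _ {a} {A : Set a} where

  -- All lists of length exactly k over xs.
  listsOf : ℕ → List A → List (List A)
  listsOf zero    xs = [ [] ]
  listsOf (suc k) xs = cartesianProductWith _∷_ xs (listsOf k xs)

  -- All lists of length at most k over xs.
  listsUpTo : ℕ → List A → List (List A)
  listsUpTo zero    xs = [ [] ]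
  listsUpTo (suc k) xs = [] ∷ cartesianProductWith _∷_ xs (listsUpTo k xs)

blocks : ℕ → List Block
blocks n = cartesianProductWith _∷_ [1⋯ n ] (listsUpTo (pred n) [1⋯ n ])

-- The elements of LLP n m, each exactly once (see ∈-LLP and LLP-unique).
LLP : ℕ → ℕ → List (List Block)
LLP n m = filter (isLLP? n m) (listsOf m (blocks n))

-- The number of indices j such that P holds of the j-th entry together with
-- the list of all entries at indices l > j.
countRL : ∀ {p} {P : ℕ → Pred (List ℕ) p} → (∀ x → Decidable (P x)) → List ℕ → ℕ
countRL P? []       = 0
countRL P? (x ∷ xs) = (if does (P? x xs) then 1 else 0) + countRL P? xs

-- Right-to-left minima exceeding the threshold t.
rl-minima> : ℕ → List ℕ → ℕ
rl-minima> t = countRL (λ x later → all? (x <?_) later ×-dec (t <? x))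

-- Entries followed by a smaller one.
non-minima : List ℕ → ℕ
non-minima = countRL (λ x later → any? (_<? x) later)

rlb : List Block → ℕ
rlb π = rl-minima> 1 (map minB π)

nsb : List Block → ℕ
nsb π = non-minima (map minB π)

rle : List Block → ℕ
rle π = sum (map (λ B → rl-minima> (minB B) (toList B)) π)

nse : List Block → ℕ
nse π = sum (map (non-minima ∘ toList) π)

-- An identity of polynomials in the indeterminates α, β, λ, μ is an identity
-- holding for all values of α, β, λ, μ in all commutative rings.
module Stirling {c ℓ} (R : CommutativeRing c ℓ) where

  open CommutativeRing R using (Carrier; 0#; 1#; semiring) renaming (_+_ to _⊕_; _*_ to _⊛_)
  open import Algebra.Properties.Semiring.Exp semiring public using (_^_)
  open import Algebra.Properties.Semiring.Mult semiring public
    using () renaming (_×_ to _·_)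

  weight : (α β λ′ μ : Carrier) → List Block → Carrier
  weight α β λ′ μ π = (α ^ rlb π) ⊛ (β ^ nsb π) ⊛ (λ′ ^ rle π) ⊛ (μ ^ nse π)

  𝕊 : ℕ → ℕ → (α β λ′ μ : Carrier) → Carrier
  𝕊 n m α β λ′ μ =
    if does ((1 ≤? m) ×-dec (m ≤? n))
    then foldr _⊕_ 0# (map (weight α β λ′ μ) (LLP n m))
    else 0#

private
  module _ {a} {A : Set a} {xs : List A} where

    ∈-listsOf⁺ : ∀ {ys} → All (_∈ xs) ys → ys ∈ listsOf (length ys) xs
    ∈-listsOf⁺ []       = here refl
    ∈-listsOf⁺ (p ∷ ps) = ∈-cartesianProductWith⁺ List._∷_ p (∈-listsOf⁺ ps)

    ∈-listsUpTo⁺ : ∀ {ys k} → length ys ≤ k → All (_∈ xs) ys → ys ∈ listsUpTo k xs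
    ∈-listsUpTo⁺ {k = zero}  z≤n     []       = here refl
    ∈-listsUpTo⁺ {k = suc k} z≤n     []       = here refl
    ∈-listsUpTo⁺             (s≤s l) (p ∷ ps) =
      there (∈-cartesianProductWith⁺ List._∷_ p (∈-listsUpTo⁺ l ps))

    ∷-inj : ∀ {w x : A} {y z : List A} → w List.∷ y ≡ x ∷ z → w ≡ x × y ≡ z
    ∷-inj refl = refl , refl

    listsOf-unique : Unique xs → ∀ k → Unique (listsOf k xs)
    listsOf-unique u zero    = [] ∷ []
    listsOf-unique u (suc k) = cartesianProductWith⁺ List._∷_ ∷-inj u (listsOf-unique u k)

    listsUpTo-unique : Unique xs → ∀ k → Unique (listsUpTo k xs)
    listsUpTo-unique u zero    = [] ∷ []
    listsUpTo-unique u (suc k) =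
      All.tabulate (λ { q refl → case q })
      ∷ cartesianProductWith⁺ List._∷_ ∷-inj u (listsUpTo-unique u k)
      where
      case : ∀ {b} {B : Set b} → List.[] ∈ cartesianProductWith List._∷_ xs (listsUpTo k xs) → B
      case q with ∈-cartesianProductWith⁻ List._∷_ xs (listsUpTo k xs) q
      ... | _ , _ , _ , _ , ()

    lookup-injective : ∀ {ys : List A} → Unique ys → ∀ i j → lookup ys i ≡ lookup ys j → i ≡ j
    lookup-injective (p ∷ u) Fin.zero    Fin.zero    e = refl
    lookup-injective (p ∷ u) Fin.zero    (Fin.suc j) e = contradiction e (All.lookup p (∈-lookup j))
    lookup-injective (p ∷ u) (Fin.suc i) Fin.zero    e = contradiction (sym e) (All.lookup p (∈-lookup i))
    lookup-injective (p ∷ u) (Fin.suc i) (Fin.suc j) e = cong Fin.suc (lookup-injective u i j e)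

    unique⇒length≤ : ∀ {ys} → Unique ys → ys ⊆ xs → length ys ≤ length xs
    unique⇒length≤ {ys} u s = injective⇒≤ {f = λ i → Any.index (s (∈-lookup i))}
      λ {i} {j} e → lookup-injective u i j
        (trans (lookup-index (s (∈-lookup i)))
          (trans (cong (lookup xs) e) (sym (lookup-index (s (∈-lookup j))))))

  ∈-blocks⁺ : ∀ {n} {B : Block} → Unique (toList B) → toList B ⊆ [1⋯ n ] → B ∈ blocks n
  ∈-blocks⁺ {n} {x ∷ xs} u s = ∈-cartesianProductWith⁺ _∷_ (s (here refl))
    (∈-listsUpTo⁺ (ℕ.pred-mono-≤ (subst (suc (length xs) ≤_)
        (trans (length-map suc (upTo n)) (length-upTo n)) (unique⇒length≤ u s)))
      (All.tabulate (s ∘ there)))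

  all∈blocks : ∀ {n} π → All Unique (map toList π) → concatMap toList π ⊆ [1⋯ n ] → All (_∈ blocks n) π
  all∈blocks []      _       _ = []
  all∈blocks (B ∷ π) (u ∷ us) s =
    ∈-blocks⁺ u (s ∘ ∈-++⁺ˡ) ∷ all∈blocks π us (s ∘ ∈-++⁺ʳ (toList B))

∈-LLP : ∀ {n m π} → π ∈ LLP n m ⇔ IsLLP n m π
∈-LLP {n} {m} {π} = mk⇔
  (λ q → proj₂ (∈-filter⁻ (isLLP? n m) {xs = listsOf m (blocks n)} q))
  (λ p → let open IsLLP p in ∈-filter⁺ (isLLP? n m)
    (subst (λ k → π ∈ listsOf k (blocks n)) #blocks (∈-listsOf⁺ (all∈blocks π linear union⊆))) p)

LLP-unique : ∀ n m → Unique (LLP n m)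
LLP-unique n m = filter⁺ (isLLP? n m) (listsOf-unique
  (cartesianProductWith⁺ _∷_ (λ { refl → refl , refl }) [n]! (listsUpTo-unique [n]! (pred n))) m)
  where
  [n]! : Unique [1⋯ n ]
  [n]! = map⁺ suc-injective (upTo⁺ n)

-- A partition of [n + 1] arises from exactly one partition of [n], either by
-- inserting {n + 1} as a new block or by inserting the letter n + 1 into a block.
-- As n + 1 is the largest letter, an insertion leaves the contribution of every
-- other block and letter to the four statistics unchanged.  A new entry in last
-- position is a right-to-left minimum (weight α or λ), and in any other position
-- it is followed by a smaller entry (weight β or μ).

module Submission where

open import Defs
open import Algebra.Bundles using (CommutativeRing)
open import Data.Bool.Base using (Bool; if_then_else_)
open import Data.List.Base
  using (List; []; _∷_; [_]; _++_; map; concatMap; filter; foldr; length; mapMaybe; upTo)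
open import Data.List.Membership.Propositional using (_∈_; _∉_; find; lose)
open import Data.List.Membership.Propositional.Properties
  using (∈-map⁺; ∈-map⁻; ∈-++⁺ˡ; ∈-++⁺ʳ; ∈-++⁻; ∈-concatMap⁺; ∈-concatMap⁻)
open import Data.List.Membership.Propositional.Properties.WithK using (unique∧set⇒bag)
open import Data.List.NonEmpty.Base using (_∷_; toList; fromList)
open import Data.List.Properties
  using (filter-accept; filter-reject; filter-all; map-∘; length-map; length-upTo; length-++; upTo-∷ʳ)
open import Data.List.Relation.Binary.BagAndSetEquality using (∼bag⇒↭)
open import Data.List.Relation.Binary.Disjoint.Propositional using (Disjoint)
open import Data.List.Relation.Binary.Permutation.Propositional
  using (_↭_; prep; swap; ↭-refl; ↭-reflexive; ↭-sym; ↭-trans; ↭⇒↭ₛ′; module PermutationReasoning)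
open import Data.List.Relation.Binary.Permutation.Propositional.Properties
  using (All-resp-↭; Any-resp-↭; ∈-resp-↭; drop-∷; shift; shifts; ∷↭∷ʳ; ↭-length; ++⁺ˡ; ++⁺ʳ)
  renaming (map⁺ to ↭-map⁺)
import Data.List.Relation.Binary.Permutation.Setoid.Properties as ↭ₛ
open import Data.List.Relation.Unary.All as All using (All; []; _∷_; all?)
open import Data.List.Relation.Unary.All.Properties as All using (¬Any⇒All¬)
open import Data.List.Relation.Unary.AllPairs using (AllPairs; []; _∷_)
open import Data.List.Relation.Unary.Any as Any using (Any; here; there; any?)
open import Data.List.Relation.Unary.Unique.Propositional using (Unique)
open import Data.List.Relation.Unary.Unique.Propositional.Properties as Unique using (upTo⁺)
open import Data.Maybe.Base using (Maybe; just)
open import Data.Nat.Base using (ℕ; zero; suc; _∸_; _⊓_; _≤_; _<_; z≤n; s≤s; s≤s⁻¹; z<s)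
  renaming (_+_ to _+ℕ_)
open import Data.Nat.Properties as ℕ using (_≟_; _<?_; _≤?_)
open import Data.Product.Base using (_×_; _,_; ∃; proj₁; proj₂)
open import Data.Sum.Base using (_⊎_; inj₁; inj₂; [_,_]′)
open import Function.Base using (_∘_)
open import Function.Bundles using (_⇔_; mk⇔; Equivalence)
open import Relation.Binary.PropositionalEquality as ≡
  using (_≡_; _≢_; refl; cong; cong₂; subst)
open import Relation.Nullary using (¬_; Dec; does; yes; no; contradiction)
open import Relation.Nullary.Decidable using (¬?; _×-dec_; dec-true; dec-false; does-⇔)

-- Insertion of an entry at all positions of a list.

module _ {a} {A : Set a} where

  inserts : A → List A → List (List A)
  inserts x []       = [ [ x ] ]
  inserts x (y ∷ ys) = (x ∷ y ∷ ys) ∷ map (y ∷_) (inserts x ys)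

  ∈-inserts⇒↭ : ∀ {x} xs {zs} → zs ∈ inserts x xs → zs ↭ x ∷ xs
  ∈-inserts⇒↭ []       (here refl) = ↭-refl
  ∈-inserts⇒↭ (y ∷ ys) (here refl) = ↭-refl
  ∈-inserts⇒↭ (y ∷ ys) (there p) with ∈-map⁻ (y ∷_) p
  ... | _ , q , refl = ↭-trans (prep y (∈-inserts⇒↭ ys q)) (swap y _ ↭-refl)

  ∈⇒∈-inserts : ∀ {x zs} → x ∈ zs → ∃ λ xs → zs ∈ inserts x xs
  ∈⇒∈-inserts {zs = _ ∷ []}     (here refl) = [] , here refl
  ∈⇒∈-inserts {zs = _ ∷ z ∷ zs} (here refl) = z ∷ zs , here refl
  ∈⇒∈-inserts {zs = z ∷ _}      (there p) with ∈⇒∈-inserts p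
  ... | xs , q = z ∷ xs , there (∈-map⁺ (z ∷_) q)

  -- Freshness tells the front insertion, with head `x`, from all later ones, which keep the old
  -- head `y`.
  inserts-unique : ∀ {x xs} → x ∉ xs → Unique (inserts x xs)
  inserts-unique {xs = []}     _    = [] ∷ []
  inserts-unique {xs = y ∷ ys} x∉xs =
    All.tabulate (λ { p refl → x∉xs (here (head≡ p)) })
    ∷ Unique.map⁺ (λ { refl → refl }) (inserts-unique (x∉xs ∘ there))
    where
    head≡ : ∀ {x ys zss} → x List.∷ ys ∈ map (y ∷_) zss → x ≡ y
    head≡ p with ∈-map⁻ (y ∷_) p
    ... | _ , _ , refl = refl

  unique-++⁻ : ∀ (xs : List A) {ys} → Unique (xs ++ ys) → Unique xs × Unique ys × Disjoint xs ys
  unique-++⁻ []       u       = [] , u , λ ()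
  unique-++⁻ (x ∷ xs) (p ∷ u) with unique-++⁻ xs u
  ... | uxs , uys , d = All.++⁻ˡ xs p ∷ uxs , uys , λ where
    (here refl , q) → All.lookup (All.++⁻ʳ xs p) q refl
    (there r   , q) → d (r , q)

map-inserts : ∀ {a b} {A : Set a} {B : Set b} (f : A → B) x xs →
  map (map f) (inserts x xs) ≡ inserts (f x) (map f xs)
map-inserts f x []       = refl
map-inserts f x (y ∷ ys) = cong ((f x ∷ f y ∷ map f ys) ∷_) (begin
  map (map f) (map (y ∷_) (inserts x ys))   ≡⟨ map-∘ (inserts x ys) ⟨
  map ((f y ∷_) ∘ map f) (inserts x ys)     ≡⟨ map-∘ (inserts x ys) ⟩
  map (f y ∷_) (map (map f) (inserts x ys)) ≡⟨ cong (map (f y ∷_)) (map-inserts f x ys) ⟩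
  map (f y ∷_) (inserts (f x) (map f ys))   ∎)
  where open ≡.≡-Reasoning

-- The map `g` recovers the source of every generated element, so distinct sources generate disjoint
-- lists. It is applied with `g` the deletion of the largest letter.
concatMap-unique : ∀ {a b} {A : Set a} {B : Set b} {f : A → List B} (g : B → A) {xs} → Unique xs →
  (∀ {x} → x ∈ xs → Unique (f x)) → (∀ {x y} → x ∈ xs → y ∈ f x → g y ≡ x) →
  Unique (concatMap f xs)
concatMap-unique g [] _ _ = []
concatMap-unique g {x ∷ xs} (x∉xs ∷ u) uf retract =
  Unique.++⁺ (uf (here refl)) (concatMap-unique g u (uf ∘ there) (retract ∘ there)) λ (p , q) →
    let y , y∈xs , p′ = find (∈-concatMap⁻ _ {xs = xs} q)
    in All.lookup x∉xs y∈xs (≡.trans (≡.sym (retract (here refl) p)) (retract (there y∈xs) p′))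

-- Without repetitions every multiplicity is 0 or 1, so membership alone fixes a list up to order.
unique∧⇔⇒↭ : ∀ {a} {A : Set a} {xs ys : List A} → Unique xs → Unique ys →
  (∀ {x} → x ∈ xs ⇔ x ∈ ys) → xs ↭ ys
unique∧⇔⇒↭ u v e = ∼bag⇒↭ (unique∧set⇒bag u v e)

-- Inserting a letter into a block

letters : List Block → List ℕ
letters = concatMap toList

-- The counterpart of `inserts` for nonempty lists: splitting off the head makes every result a
-- block by construction.
insertsB : ℕ → Block → List Block
insertsB x (y ∷ ys) = (x ∷ y ∷ ys) ∷ map (y ∷_) (inserts x ys)

map-toList-insertsB : ∀ x B → map toList (insertsB x B) ≡ inserts x (toList B)
map-toList-insertsB x (y ∷ ys) = cong ((x ∷ y ∷ ys) ∷_) (≡.sym (map-∘ (inserts x ys)))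

∈-insertsB⁻ : ∀ {x B′} B → B′ ∈ insertsB x B → toList B′ ∈ inserts x (toList B)
∈-insertsB⁻ {B′ = B′} B p = subst (toList B′ ∈_) (map-toList-insertsB _ B) (∈-map⁺ toList p)

insertsB-unique : ∀ {x} B → x ∉ toList B → Unique (insertsB x B)
insertsB-unique B x∉B = Unique.map⁻ (subst Unique (≡.sym (map-toList-insertsB _ B)) (inserts-unique x∉B))

joins : ℕ → List Block → List (List Block)
joins x []      = []
joins x (B ∷ π) = map (_∷ π) (insertsB x B) ++ map (B ∷_) (joins x π)

-- Case analysis for membership in `joins`: the letter went into the first block or into a later
-- one.
data JoinsView (x : ℕ) (B : Block) (π : List Block) : List Block → Set where
  here  : ∀ {B′} → B′ ∈ insertsB x B → JoinsView x B π (B′ ∷ π)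
  there : ∀ {π′} → π′ ∈ joins x π → JoinsView x B π (B ∷ π′)

joinsView : ∀ {x} B π {σ} → σ ∈ joins x (B ∷ π) → JoinsView x B π σ
joinsView {x} B π p with ∈-++⁻ (map (_∷ π) (insertsB x B)) p
... | inj₁ q with ∈-map⁻ (_∷ π) q
...   | _ , r , refl = here r
joinsView {x} B π p | inj₂ q with ∈-map⁻ (B ∷_) q
...   | _ , r , refl = there r

joins-unique : ∀ {x} π → x ∉ letters π → Unique (joins x π)
joins-unique []      _   = []
joins-unique {x} (B ∷ π) x∉π =
  Unique.++⁺ (Unique.map⁺ (λ { refl → refl }) (insertsB-unique B (x∉π ∘ ∈-++⁺ˡ)))
             (Unique.map⁺ (λ { refl → refl }) (joins-unique π (x∉π ∘ ∈-++⁺ʳ (toList B))))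
             λ (p , q) → apart (∈-map⁻ (_∷ π) p) (∈-map⁻ (B ∷_) q)
  where
  apart : ∀ {σ} → (∃ λ B′ → B′ ∈ insertsB x B × σ ≡ B′ ∷ π) →
          ¬ (∃ λ π′ → π′ ∈ joins x π × σ ≡ B ∷ π′)
  apart (_ , r , refl) (_ , _ , refl) =
    -- The two matches on `refl` have identified the enlarged first block with `B`, so `B` would
    -- contain `x`.
    x∉π (∈-++⁺ˡ (∈-resp-↭ (↭-sym (∈-inserts⇒↭ (toList B) (∈-insertsB⁻ B r))) (here refl)))

∈-joins⇒↭ : ∀ {x} π {σ} → σ ∈ joins x π → letters σ ↭ x ∷ letters π
∈-joins⇒↭ (B ∷ π) p with joinsView B π p
... | here q  = ++⁺ʳ (letters π) (∈-inserts⇒↭ (toList B) (∈-insertsB⁻ B q))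
... | there q = ↭-trans (++⁺ˡ (toList B) (∈-joins⇒↭ π q)) (shift _ (toList B) (letters π))

∈-joins⇒length≡ : ∀ {x} π {σ} → σ ∈ joins x π → length σ ≡ length π
∈-joins⇒length≡ (B ∷ π) p with joinsView B π p
... | here  _ = refl
... | there q = cong suc (∈-joins⇒length≡ π q)

letters-↭ : ∀ {σ π} → σ ↭ π → letters σ ↭ letters π
letters-↭ _↭_.refl        = ↭-refl
letters-↭ (prep B p)      = ++⁺ˡ (toList B) (letters-↭ p)
letters-↭ {_} {_ ∷ _ ∷ π} (swap B C p) = begin
  toList B ++ toList C ++ _         ↭⟨ ++⁺ˡ (toList B) (++⁺ˡ (toList C) (letters-↭ p)) ⟩
  toList B ++ toList C ++ letters π ↭⟨ shifts (toList B) (toList C) ⟩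
  toList C ++ toList B ++ letters π ∎
  where open PermutationReasoning
letters-↭ (_↭_.trans p q) = ↭-trans (letters-↭ p) (letters-↭ q)

-- Recognizing the two kinds of extension.

NewBlock NewLetter : ℕ → List Block → Set
NewBlock  x σ = ∃ λ π → σ ∈ inserts (x ∷ []) π
NewLetter x σ = ∃ λ π → σ ∈ joins x π

-- If the block of `x` is `x` alone, removing it removes a whole block. Otherwise another letter
-- remains, so what is left of the block is still a block, into which `x` was inserted.
∈⇒new : ∀ {x} σ → x ∈ letters σ → NewBlock x σ ⊎ NewLetter x σ
∈⇒new {x} (B ∷ σ) p with ∈-++⁻ (toList B) p
∈⇒new (B ∷ σ) p | inj₂ q with ∈⇒new σ q
... | inj₁ (π , r) = inj₁ (B ∷ π , there (∈-map⁺ (B ∷_) r))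
... | inj₂ (π , r) = inj₂ (B ∷ π , ∈-++⁺ʳ (map (_∷ π) (insertsB _ B)) (∈-map⁺ (B ∷_) r))
∈⇒new ((_ ∷ [])    ∷ [])    p | inj₁ (here refl) = inj₁ ([] , here refl)
∈⇒new ((_ ∷ [])    ∷ C ∷ σ) p | inj₁ (here refl) = inj₁ (C ∷ σ , here refl)
∈⇒new ((_ ∷ y ∷ B) ∷ σ)     p | inj₁ (here refl) = inj₂ ((y ∷ B) ∷ σ , here refl)
∈⇒new ((y ∷ B)     ∷ σ)     p | inj₁ (there q) with ∈⇒∈-inserts q
... | B′ , r = inj₂ ((y ∷ B′) ∷ σ , there (∈-++⁺ˡ (∈-map⁺ (_∷ σ) (∈-map⁺ (y ∷_) r))))

-- Deleting a letter: it undoes both kinds of insertion, so an extension determines its origin.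

_≢?_ : ∀ (x y : ℕ) → Dec (x ≢ y)
x ≢? y = ¬? (x ≟ y)

-- A block that loses its only letter becomes `nothing` and is dropped by `mapMaybe`; hence the same
-- deletion undoes a new block and a new letter.
deleteB : ℕ → Block → Maybe Block
deleteB x = fromList ∘ filter (x ≢?_) ∘ toList

delete : ℕ → List Block → List Block
delete x = mapMaybe (deleteB x)

filter-inserts : ∀ {x} xs → x ∉ xs → ∀ {zs} → zs ∈ inserts x xs → filter (x ≢?_) zs ≡ xs
filter-inserts {x} [] _ (here refl) = filter-reject (x ≢?_) (λ x≢x → x≢x refl)
filter-inserts {x} (y ∷ ys) x∉ (here refl) = ≡.trans
  (filter-reject (x ≢?_) (λ x≢x → x≢x refl)) (filter-all (x ≢?_) (¬Any⇒All¬ _ x∉))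
filter-inserts {x} (y ∷ ys) x∉ (there p) with ∈-map⁻ (y ∷_) p
... | _ , q , refl = ≡.trans (filter-accept (x ≢?_) (x∉ ∘ here)) (cong (y ∷_) (filter-inserts ys (x∉ ∘ there) q))

deleteB-fresh : ∀ {x} B → x ∉ toList B → deleteB x B ≡ just B
deleteB-fresh {x} B x∉B = cong fromList (filter-all (x ≢?_) {toList B} (¬Any⇒All¬ _ x∉B))

delete-∷-fresh : ∀ {x} B π → x ∉ toList B → delete x (B ∷ π) ≡ B ∷ delete x π
delete-∷-fresh {x} B π x∉B rewrite deleteB-fresh B x∉B = refl

delete-fresh : ∀ {x} π → x ∉ letters π → delete x π ≡ π
delete-fresh []      _  = refl
delete-fresh (B ∷ π) x∉ =
  ≡.trans (delete-∷-fresh B π (x∉ ∘ ∈-++⁺ˡ)) (cong (B ∷_) (delete-fresh π (x∉ ∘ ∈-++⁺ʳ (toList B))))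

delete-[x] : ∀ x π → delete x ((x ∷ []) ∷ π) ≡ delete x π
delete-[x] x π rewrite filter-reject (x ≢?_) {x} {[]} (λ f → f refl) = refl

delete-inserts : ∀ {x} π → x ∉ letters π → ∀ {σ} → σ ∈ inserts (x ∷ []) π → delete x σ ≡ π
delete-inserts {x} [] _ (here refl) = delete-[x] x []
delete-inserts {x} (B ∷ π) x∉ (here refl) = ≡.trans (delete-[x] x (B ∷ π)) (delete-fresh (B ∷ π) x∉)
delete-inserts (B ∷ π) x∉ (there p) with ∈-map⁻ (B ∷_) p
... | σ , q , refl = ≡.trans (delete-∷-fresh B σ (x∉ ∘ ∈-++⁺ˡ))
  (cong (B ∷_) (delete-inserts π (x∉ ∘ ∈-++⁺ʳ (toList B)) q))

delete-joins : ∀ {x} π → x ∉ letters π → ∀ {σ} → σ ∈ joins x π → delete x σ ≡ π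
delete-joins {x} (B ∷ π) x∉ p with joinsView B π p
... | here q rewrite filter-inserts (toList B) (x∉ ∘ ∈-++⁺ˡ) (∈-insertsB⁻ B q) =
  cong (B ∷_) (delete-fresh π (x∉ ∘ ∈-++⁺ʳ (toList B)))
... | there {σ} q = ≡.trans (delete-∷-fresh B σ (x∉ ∘ ∈-++⁺ˡ))
  (cong (B ∷_) (delete-joins π (x∉ ∘ ∈-++⁺ʳ (toList B)) q))

-- The recursive structure of LLP

[1⋯]-unique : ∀ n → Unique [1⋯ n ]
[1⋯]-unique n = Unique.map⁺ ℕ.suc-injective (upTo⁺ n)

[1⋯suc]↭ : ∀ n → [1⋯ suc n ] ↭ suc n ∷ [1⋯ n ]
[1⋯suc]↭ n = ↭-map⁺ suc (↭-trans (↭-reflexive (≡.sym (upTo-∷ʳ n))) (↭-sym (∷↭∷ʳ n _)))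

length-[1⋯] : ∀ n → length [1⋯ n ] ≡ n
length-[1⋯] n = ≡.trans (length-map suc (upTo n)) (length-upTo n)

-- Words without repetition that are pairwise disjoint concatenate to a word without repetition, so
-- having the right set of letters means being a permutation. With its converse `∈-LLP⁺`, this
-- reduces the five conditions to two that insertions transform easily.
∈-LLP⁻ : ∀ n m {π} → π ∈ LLP n m → length π ≡ m × letters π ↭ [1⋯ n ]
∈-LLP⁻ n m π∈ = #blocks , unique∧⇔⇒↭ (Unique.concat⁺ linear disjoint) ([1⋯]-unique n) (mk⇔ union⊆ union⊇)
  where open IsLLP (Equivalence.to (∈-LLP {n} {m}) π∈)

unique⇒linear : ∀ π → Unique (letters π) → All Unique (map toList π)
unique⇒linear []      _ = []
unique⇒linear (B ∷ π) u = let uB , uπ , _ = unique-++⁻ (toList B) u in uB ∷ unique⇒linear π uπ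

unique⇒disjoint : ∀ π → Unique (letters π) → AllPairs Disjoint (map toList π)
unique⇒disjoint []      _ = []
unique⇒disjoint (B ∷ π) u =
  let _ , uπ , d = unique-++⁻ (toList B) u
  in All.map⁺ (All.tabulate λ C∈π (p , q) → d (p , ∈-concatMap⁺ toList (lose C∈π q)))
     ∷ unique⇒disjoint π uπ

∈-LLP⁺ : ∀ n m π → length π ≡ m → letters π ↭ [1⋯ n ] → π ∈ LLP n m
∈-LLP⁺ n m π l p = Equivalence.from (∈-LLP {n} {m}) record
  { #blocks = l ; linear = unique⇒linear π u ; disjoint = unique⇒disjoint π u
  ; union⊆ = ∈-resp-↭ p ; union⊇ = ∈-resp-↭ (↭-sym p) }
  where
  u : Unique (letters π)
  u = ↭ₛ.Unique-resp-↭ (≡.setoid ℕ) (↭⇒↭ₛ′ ≡.isEquivalence (↭-sym p)) ([1⋯]-unique n)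

∈-LLP⇒< : ∀ n m {π} → π ∈ LLP n m → All (_< suc n) (letters π)
∈-LLP⇒< n m π∈ = All-resp-↭ (↭-sym (proj₂ (∈-LLP⁻ n m π∈))) (All.map⁺ (upTo< n))
  where
  upTo< : ∀ n → All (λ i → suc i < suc n) (upTo n)
  upTo< n = All.applyUpTo⁺₁ _ n s≤s

∈-LLP⇒fresh : ∀ n m {π} → π ∈ LLP n m → suc n ∉ letters π
∈-LLP⇒fresh n m π∈ p = ℕ.<-irrefl refl (All.lookup (∈-LLP⇒< n m π∈) p)

-- The expected members of `LLP (suc n) (suc m)`: a new block raises the number of blocks from `m`,
-- while a new letter leaves it at `suc m`.
extend : ℕ → ℕ → List (List Block)
extend n m = concatMap (inserts (suc n ∷ [])) (LLP n m) ++ concatMap (joins (suc n)) (LLP n (suc m))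

extend-unique : ∀ n m → Unique (extend n m)
extend-unique n m = Unique.++⁺
  (concatMap-unique (delete (suc n)) (LLP-unique n m)
    (λ π∈ → inserts-unique (λ p → ∈-LLP⇒fresh n m π∈ (∈-concatMap⁺ toList (lose p (here refl)))))
    (λ {π} π∈ → delete-inserts π (∈-LLP⇒fresh n m π∈)))
  (concatMap-unique (delete (suc n)) (LLP-unique n (suc m))
    (λ {π} π∈ → joins-unique π (∈-LLP⇒fresh n (suc m) π∈))
    (λ {π} π∈ → delete-joins π (∈-LLP⇒fresh n (suc m) π∈)))
  -- A partition of both kinds would, by deletion of `suc n`, have one origin with both `m` and
  -- `suc m` blocks.
  λ (p , q) →
    let π , π∈ , p′ = find (∈-concatMap⁻ (inserts (suc n ∷ [])) {xs = LLP n m} p)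
        ρ , ρ∈ , q′ = find (∈-concatMap⁻ (joins (suc n)) {xs = LLP n (suc m)} q)
        π≡ρ = ≡.trans (≡.sym (delete-inserts π (∈-LLP⇒fresh n m π∈) p′))
                      (delete-joins ρ (∈-LLP⇒fresh n (suc m) ρ∈) q′)
    in ℕ.1+n≢n (≡.trans (≡.sym (proj₁ (∈-LLP⁻ n (suc m) ρ∈)))
         (≡.trans (≡.sym (cong length π≡ρ)) (proj₁ (∈-LLP⁻ n m π∈))))

-- Both lists are free of repetitions, so it suffices to compare members; `peel` and `grow` cancel
-- and restore the letter `suc n`.
LLP-suc-↭ : ∀ n m → LLP (suc n) (suc m) ↭ extend n m
LLP-suc-↭ n m = unique∧⇔⇒↭ (LLP-unique (suc n) (suc m)) (extend-unique n m) (mk⇔ to from)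
  where
  with-block with-letter : List (List Block)
  with-block  = concatMap (inserts (suc n ∷ [])) (LLP n m)
  with-letter = concatMap (joins (suc n)) (LLP n (suc m))

  module _ {σ π} (q : letters σ ↭ suc n ∷ letters π) where

    peel : letters σ ↭ [1⋯ suc n ] → letters π ↭ [1⋯ n ]
    peel p = drop-∷ (↭-trans (↭-sym q) (↭-trans p ([1⋯suc]↭ n)))

    grow : letters π ↭ [1⋯ n ] → letters σ ↭ [1⋯ suc n ]
    grow p = ↭-trans q (↭-trans (prep (suc n) p) (↭-sym ([1⋯suc]↭ n)))

  to : ∀ {σ} → σ ∈ LLP (suc n) (suc m) → σ ∈ extend n m
  -- The letter `suc n` must occur somewhere in `σ`, and its block decides the kind of extension.
  to {σ} σ∈ = [ block , letter ]′ (∈⇒new σ (∈-resp-↭ (↭-sym (↭-trans p ([1⋯suc]↭ n))) (here refl)))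
    where
    l = proj₁ (∈-LLP⁻ (suc n) (suc m) σ∈)
    p = proj₂ (∈-LLP⁻ (suc n) (suc m) σ∈)

    block : NewBlock (suc n) σ → σ ∈ extend n m
    block (π , q) = ∈-++⁺ˡ (∈-concatMap⁺ _ (lose (∈-LLP⁺ n m π
      (ℕ.suc-injective (≡.trans (≡.sym (↭-length r)) l))
      (peel {σ} {π} (letters-↭ r) p)) q))
      where r = ∈-inserts⇒↭ π q

    letter : NewLetter (suc n) σ → σ ∈ extend n m
    letter (π , q) = ∈-++⁺ʳ with-block (∈-concatMap⁺ _ (lose (∈-LLP⁺ n (suc m) π
      (≡.trans (≡.sym (∈-joins⇒length≡ π q)) l)
      (peel {σ} {π} (∈-joins⇒↭ π q) p)) q))

  from : ∀ {σ} → σ ∈ extend n m → σ ∈ LLP (suc n) (suc m)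
  from {σ} = [ block , letter ]′ ∘ ∈-++⁻ with-block
    where
    block : σ ∈ with-block → σ ∈ LLP (suc n) (suc m)
    block p =
      let π , π∈ , q = find (∈-concatMap⁻ (inserts (suc n ∷ [])) {xs = LLP n m} p)
          l , r      = ∈-LLP⁻ n m π∈
          s          = ∈-inserts⇒↭ π q
      in ∈-LLP⁺ (suc n) (suc m) σ (≡.trans (↭-length s) (cong suc l)) (grow {σ} {π} (letters-↭ s) r)

    letter : σ ∈ with-letter → σ ∈ LLP (suc n) (suc m)
    letter p =
      let π , π∈ , q = find (∈-concatMap⁻ (joins (suc n)) {xs = LLP n (suc m)} p)
          l , r      = ∈-LLP⁻ n (suc m) π∈
      in ∈-LLP⁺ (suc n) (suc m) σ (≡.trans (∈-joins⇒length≡ π q) l) (grow {σ} {π} (∈-joins⇒↭ π q) r)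

-- Index pairs without partitions.

length≤letters : ∀ π → length π ≤ length (letters π)
length≤letters []             = z≤n
length≤letters ((x ∷ xs) ∷ π) = s≤s (ℕ.≤-trans (length≤letters π)
  (ℕ.≤-trans (ℕ.m≤n+m _ (length xs)) (ℕ.≤-reflexive (≡.sym (length-++ xs)))))

empty : ∀ {a} {A : Set a} {xs : List A} → (∀ {x} → x ∉ xs) → xs ≡ []
empty {xs = []}     _ = refl
empty {xs = x ∷ xs} e = contradiction (here refl) e

length-letters : ∀ n m {π} → π ∈ LLP n m → length (letters π) ≡ n
length-letters n m π∈ = ≡.trans (↭-length (proj₂ (∈-LLP⁻ n m π∈))) (length-[1⋯] _)

LLP-suc-0≡[] : ∀ n → LLP (suc n) 0 ≡ []
LLP-suc-0≡[] n = empty λ {π} π∈ → no-letters π (proj₁ (∈-LLP⁻ (suc n) 0 π∈)) (length-letters (suc n) 0 π∈)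
  where
  no-letters : ∀ π → length π ≡ 0 → ¬ (length (letters π) ≡ suc n)
  no-letters [] _ ()

-- Every block uses up at least one letter. Together with `LLP-suc-0≡[]` this matches the zero
-- values of `𝕊` with empty sums.
m>n⇒LLP≡[] : ∀ {n m} → n < m → LLP n m ≡ []
m>n⇒LLP≡[] {n} {m} n<m = empty λ {π} π∈ → ℕ.<⇒≱ n<m (≡.subst₂ _≤_
  (proj₁ (∈-LLP⁻ n m π∈)) (length-letters n m π∈) (length≤letters π))

-- Block minima

minB≤head : ∀ y ys → minB (y ∷ ys) ≤ y
minB≤head y []       = ℕ.≤-refl
minB≤head y (z ∷ zs) = ℕ.m⊓n≤m y _

-- The tail `ys` may be empty and so have no minimum of its own; the head `y`, smaller than `x`, is
-- kept in front to absorb `x`.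
minB-inserts : ∀ {x y} → y < x → ∀ {ys} → All (_< x) ys → ∀ {zs} → zs ∈ inserts x ys →
  minB (y ∷ zs) ≡ minB (y ∷ ys)
minB-inserts y<x []          (here refl) = ℕ.m≤n⇒m⊓n≡m (ℕ.<⇒≤ y<x)
minB-inserts {y = y} y<x {y′ ∷ ys} (y′<x ∷ _) (here refl) =
  cong (y ⊓_) (ℕ.m≥n⇒m⊓n≡n (ℕ.≤-trans (minB≤head y′ ys) (ℕ.<⇒≤ y′<x)))
minB-inserts {y = y} y<x {y′ ∷ ys} (y′<x ∷ ys<x) (there p) with ∈-map⁻ (y′ ∷_) p
... | _ , q , refl = cong (y ⊓_) (minB-inserts y′<x ys<x q)

minB-insertsB : ∀ {x} B → All (_< x) (toList B) → ∀ {B′} → B′ ∈ insertsB x B → minB B′ ≡ minB B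
minB-insertsB (y ∷ ys) (y<x ∷ _) (here refl) =
  ℕ.m≥n⇒m⊓n≡n (ℕ.≤-trans (minB≤head y ys) (ℕ.<⇒≤ y<x))
minB-insertsB (y ∷ ys) (y<x ∷ ys<x) (there p) with ∈-map⁻ (y ∷_) p
... | _ , q , refl = minB-inserts y<x ys<x q

-- As `rlb` and `nsb` see only the minima, a new letter leaves both unchanged.
map-minB-joins : ∀ {x} π → All (_< x) (letters π) → ∀ {σ} → σ ∈ joins x π → map minB σ ≡ map minB π
map-minB-joins (B ∷ π) π<x p with joinsView B π p
... | here q  = cong (_∷ map minB π) (minB-insertsB B (All.++⁻ˡ (toList B) π<x) q)
... | there q = cong (minB B ∷_) (map-minB-joins π (All.++⁻ʳ (toList B) π<x) q)

minB< : ∀ {x} B → All (_< x) (toList B) → minB B < x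
minB< (y ∷ ys) (y<x ∷ _) = ℕ.≤-<-trans (minB≤head y ys) y<x

minima< : ∀ {x} π → All (_< x) (letters π) → All (_< x) (map minB π)
minima< []      _   = []
minima< (B ∷ π) π<x = minB< B (All.++⁻ˡ (toList B) π<x) ∷ minima< π (All.++⁻ʳ (toList B) π<x)

-- The contribution of a single entry to the two counts

𝟙 : Bool → ℕ
𝟙 b = if b then 1 else 0

rl-head : ℕ → ℕ → List ℕ → ℕ
rl-head t x xs = 𝟙 (does (all? (x <?_) xs ×-dec (t <? x)))

non-min-head : ℕ → List ℕ → ℕ
non-min-head x xs = 𝟙 (does (any? (_<? x) xs))

module _ {x y} (y<x : y < x) {ys zs} (p : zs ∈ inserts x ys) where

  -- A later entry larger than `y` cannot spoil `y` being below all later entries, and the threshold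
  -- test concerns `y` alone.
  rl-head-inserts : ∀ t → rl-head t y zs ≡ rl-head t y ys
  rl-head-inserts t = cong 𝟙 (does-⇔ (mk⇔
    (λ (a , b) → All.tail (All-resp-↭ (∈-inserts⇒↭ ys p) a) , b)
    (λ (a , b) → All-resp-↭ (↭-sym (∈-inserts⇒↭ ys p)) (y<x ∷ a) , b))
    (all? (y <?_) zs ×-dec (t <? y)) (all? (y <?_) ys ×-dec (t <? y)))

  non-min-head-inserts : non-min-head y zs ≡ non-min-head y ys
  non-min-head-inserts = cong 𝟙 (does-⇔ (mk⇔
    -- The smaller entry that follows `y` cannot be `x`, so it lies in `ys`.
    (λ a → Any.tail (ℕ.<-asym y<x) (Any-resp-↭ (∈-inserts⇒↭ ys p) a))
    (λ a → Any-resp-↭ (↭-sym (∈-inserts⇒↭ ys p)) (there a)))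
    (any? (_<? y) zs) (any? (_<? y) ys))

-- Sums of weights in a commutative ring.

module WeightSums {c ℓ} (R : CommutativeRing c ℓ) where

  open CommutativeRing R renaming (_+_ to _⊕_; _*_ to _⊛_; refl to ≈-refl; sym to ≈-sym; trans to ≈-trans)
  open Stirling R
  open import Algebra.Properties.Semiring.Exp semiring using (^-homo-*; ^-congʳ)
  open import Algebra.Properties.Semiring.Mult semiring using (×-homo-+)
  open import Algebra.Properties.CommutativeSemigroup *-commutativeSemigroup
    using (x∙yz≈y∙xz; interchange)
  open import Algebra.Properties.CommutativeSemigroup +-commutativeSemigroup
    using () renaming (interchange to +-interchange; x∙yz≈y∙xz to x+yz≈y+xz)
  open import Relation.Binary.Reasoning.Setoid setoid

  Σ : ∀ {a} {A : Set a} → (A → Carrier) → List A → Carrier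
  Σ f xs = foldr _⊕_ 0# (map f xs)

  module _ {a} {A : Set a} where

    Σ-cong : ∀ {f g : A → Carrier} xs → (∀ {x} → x ∈ xs → f x ≈ g x) → Σ f xs ≈ Σ g xs
    Σ-cong []       _ = ≈-refl
    Σ-cong (x ∷ xs) e = +-cong (e (here refl)) (Σ-cong xs (e ∘ there))

    Σ-*ˡ : ∀ k (f : A → Carrier) xs → Σ (λ x → k ⊛ f x) xs ≈ k ⊛ Σ f xs
    Σ-*ˡ k f []       = ≈-sym (zeroʳ k)
    Σ-*ˡ k f (x ∷ xs) = ≈-trans (+-congˡ (Σ-*ˡ k f xs)) (≈-sym (distribˡ k _ _))

    Σ-*ʳ : ∀ k (f : A → Carrier) xs → Σ (λ x → f x ⊛ k) xs ≈ Σ f xs ⊛ k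
    Σ-*ʳ k f []       = ≈-sym (zeroˡ k)
    Σ-*ʳ k f (x ∷ xs) = ≈-trans (+-congˡ (Σ-*ʳ k f xs)) (≈-sym (distribʳ k _ _))

    Σ-++ : ∀ (f : A → Carrier) xs ys → Σ f (xs ++ ys) ≈ Σ f xs ⊕ Σ f ys
    Σ-++ f []       ys = ≈-sym (+-identityˡ _)
    Σ-++ f (x ∷ xs) ys = ≈-trans (+-congˡ (Σ-++ f xs ys)) (≈-sym (+-assoc _ _ _))

    Σ-map : ∀ {b} {B : Set b} (f : A → Carrier) (g : B → A) xs → Σ f (map g xs) ≡ Σ (f ∘ g) xs
    Σ-map f g xs = cong (foldr _⊕_ 0#) (≡.sym (map-∘ xs))

    Σ-concatMap : ∀ {b} {B : Set b} (f : A → Carrier) (g : B → List A) xs →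
      Σ f (concatMap g xs) ≈ Σ (λ x → Σ f (g x)) xs
    Σ-concatMap f g []       = ≈-refl
    Σ-concatMap f g (x ∷ xs) = ≈-trans (Σ-++ f (g x) _) (+-congˡ (Σ-concatMap f g xs))

    Σ-↭ : ∀ (f : A → Carrier) {xs ys} → xs ↭ ys → Σ f xs ≈ Σ f ys
    Σ-↭ f p = ↭ₛ.foldr-commMonoid setoid +-isCommutativeMonoid (↭⇒↭ₛ′ isEquivalence (↭-map⁺ f p))

  -- The weight of a single word.

  module _ (a b : Carrier) (t : ℕ) where

    -- One monomial serves both levels: with `α`, `β` and threshold 1 it weighs the sequence of
    -- block minima, and with `λ′`, `μ` and threshold `minB B` the letters of a block `B`.
    word : List ℕ → Carrier
    word xs = a ^ rl-minima> t xs ⊛ b ^ non-minima xs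

    word-∷ : ∀ x xs → word (x ∷ xs) ≈ (a ^ rl-head t x xs ⊛ b ^ non-min-head x xs) ⊛ word xs
    word-∷ x xs = ≈-trans
      (*-cong (^-homo-* a (rl-head t x xs) _) (^-homo-* b (non-min-head x xs) _))
      (interchange _ _ _ _)

    word-[x] : ∀ {x} → t < x → word [ x ] ≈ a
    word-[x] {x} t<x rewrite dec-true (t <? x) t<x =
      ≈-trans (*-identityʳ _) (*-identityʳ a)

    word-nonminimal-∷ : ∀ {x y} ys → y < x → word (x ∷ y ∷ ys) ≈ b ⊛ word (y ∷ ys)
    word-nonminimal-∷ {x} {y} ys y<x
      rewrite dec-false (all? (x <?_) (y ∷ ys) ×-dec (t <? x)) (λ { (x<y ∷ _ , _) → ℕ.<-asym y<x x<y })
            | dec-true (any? (_<? x) (y ∷ ys)) (here y<x)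
      = x∙yz≈y∙xz _ _ _

    -- The last position contributes `a`, as `x` exceeds the threshold, and each of the `length xs`
    -- earlier positions contributes `b`. In the induction the front insertion supplies one `b`, and
    -- all others share the unchanged factor `h` of the head.
    Σ-word-inserts : ∀ {x} → t < x → ∀ {xs} → All (_< x) xs →
      Σ word (inserts x xs) ≈ (a ⊕ length xs · b) ⊛ word xs
    Σ-word-inserts {x} t<x [] = begin
      -- The only position in the empty word is the last one; the `0#` that ends the sum doubles as
      -- `0 · b`.
      word [ x ] ⊕ 0#         ≈⟨ +-congʳ (word-[x] t<x) ⟩
      a ⊕ 0#                  ≈⟨ *-identityʳ _ ⟨
      (a ⊕ 0#) ⊛ 1#           ≈⟨ *-congˡ (*-identityʳ 1#) ⟨
      (a ⊕ 0#) ⊛ (1# ⊛ 1#)    ∎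
    Σ-word-inserts {x} t<x {y ∷ ys} (y<x ∷ ys<x) = begin
      word (x ∷ y ∷ ys) ⊕ Σ word (map (y ∷_) (inserts x ys))
        ≈⟨ +-cong (word-nonminimal-∷ ys y<x) (reflexive (Σ-map word (y ∷_) (inserts x ys))) ⟩
      b ⊛ word (y ∷ ys) ⊕ Σ (word ∘ (y ∷_)) (inserts x ys)
        ≈⟨ +-congˡ (Σ-cong (inserts x ys) factor) ⟩
      b ⊛ word (y ∷ ys) ⊕ Σ (λ zs → h ⊛ word zs) (inserts x ys)
        ≈⟨ +-congˡ (Σ-*ˡ h word (inserts x ys)) ⟩
      b ⊛ word (y ∷ ys) ⊕ h ⊛ Σ word (inserts x ys)
        ≈⟨ +-congˡ (*-congˡ (Σ-word-inserts t<x ys<x)) ⟩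
      b ⊛ word (y ∷ ys) ⊕ h ⊛ ((a ⊕ length ys · b) ⊛ word ys)
        ≈⟨ +-congˡ (x∙yz≈y∙xz _ _ _) ⟩
      b ⊛ word (y ∷ ys) ⊕ (a ⊕ length ys · b) ⊛ (h ⊛ word ys)
        ≈⟨ +-congˡ (*-congˡ (word-∷ y ys)) ⟨
      b ⊛ word (y ∷ ys) ⊕ (a ⊕ length ys · b) ⊛ word (y ∷ ys)
        ≈⟨ distribʳ _ _ _ ⟨
      (b ⊕ (a ⊕ length ys · b)) ⊛ word (y ∷ ys)
        ≈⟨ *-congʳ (x+yz≈y+xz _ _ _) ⟩
      (a ⊕ (b ⊕ length ys · b)) ⊛ word (y ∷ ys) ∎
      where
      h = a ^ rl-head t y ys ⊛ b ^ non-min-head y ys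
      factor : ∀ {zs} → zs ∈ inserts x ys → word (y ∷ zs) ≈ h ⊛ word zs
      factor {zs} p = ≈-trans (word-∷ y zs) (*-congʳ (*-cong
        (^-congʳ a (rl-head-inserts y<x p t)) (^-congʳ b (non-min-head-inserts y<x p))))

  -- Weights of partitions and the recurrence.

  module _ (α β λ′ μ : Carrier) where

    outer : List Block → Carrier
    outer π = word α β 1 (map minB π)

    inner : List Block → Carrier
    inner π = λ′ ^ rle π ⊛ μ ^ nse π

    innerB : Block → Carrier
    innerB B = word λ′ μ (minB B) (toList B)

    weight≈ : ∀ π → weight α β λ′ μ π ≈ outer π ⊛ inner π
    weight≈ π = *-assoc _ _ _

    inner-∷ : ∀ B π → inner (B ∷ π) ≈ innerB B ⊛ inner π
    inner-∷ B π = ≈-trans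
      (*-cong (^-homo-* λ′ (rl-minima> (minB B) (toList B)) _) (^-homo-* μ (non-minima (toList B)) _))
      (interchange _ _ _ _)

    -- The single letter is the minimum of its block, so it does not exceed the threshold, and
    -- nothing follows it.
    innerB-[x] : ∀ x → innerB (x ∷ []) ≈ 1#
    innerB-[x] x rewrite dec-false (x <? x) (ℕ.<-irrefl refl) = *-identityʳ 1#

    inner-inserts : ∀ {x} π {σ} → σ ∈ inserts (x ∷ []) π → inner σ ≈ inner π
    inner-inserts {x} [] (here refl) =
      ≈-trans (inner-∷ (x ∷ []) []) (≈-trans (*-congʳ (innerB-[x] x)) (*-identityˡ _))
    inner-inserts {x} (B ∷ π) (here refl) =
      ≈-trans (inner-∷ (x ∷ []) (B ∷ π)) (≈-trans (*-congʳ (innerB-[x] x)) (*-identityˡ _))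
    inner-inserts (B ∷ π) (there p) with ∈-map⁻ (B ∷_) p
    ... | σ , q , refl =
      ≈-trans (inner-∷ B σ) (≈-trans (*-congˡ (inner-inserts π q)) (≈-sym (inner-∷ B π)))

    -- A singleton block has inner weight 1, so only the sequence of minima changes, and there `x`
    -- is inserted as a largest entry above the threshold 1.
    Σ-weight-inserts : ∀ {x} → 1 < x → ∀ π → All (_< x) (letters π) →
      Σ (weight α β λ′ μ) (inserts (x ∷ []) π) ≈ (α ⊕ length π · β) ⊛ weight α β λ′ μ π
    Σ-weight-inserts {x} 1<x π π<x = begin
      Σ (weight α β λ′ μ) I                ≈⟨ Σ-cong I (λ {σ} p → ≈-trans (weight≈ σ) (*-congˡ (inner-inserts π p))) ⟩
      Σ (λ σ → outer σ ⊛ inner π) I        ≈⟨ Σ-*ʳ (inner π) outer I ⟩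
      Σ outer I ⊛ inner π                  ≡⟨ cong (_⊛ inner π) (Σ-map (word α β 1) (map minB) I) ⟨
      Σ (word α β 1) (map (map minB) I) ⊛ inner π
        ≡⟨ cong (λ J → Σ (word α β 1) J ⊛ inner π) (map-inserts minB (x ∷ []) π) ⟩
      Σ (word α β 1) (inserts x (map minB π)) ⊛ inner π
        ≈⟨ *-congʳ (Σ-word-inserts α β 1 1<x (minima< π π<x)) ⟩
      (α ⊕ length (map minB π) · β) ⊛ outer π ⊛ inner π
        ≡⟨ cong (λ k → (α ⊕ k · β) ⊛ outer π ⊛ inner π) (length-map minB π) ⟩
      (α ⊕ length π · β) ⊛ outer π ⊛ inner π
        ≈⟨ *-assoc _ _ _ ⟩
      (α ⊕ length π · β) ⊛ (outer π ⊛ inner π)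
        ≈⟨ *-congˡ (weight≈ π) ⟨
      (α ⊕ length π · β) ⊛ weight α β λ′ μ π ∎
      where I = inserts (x ∷ []) π

    Σ-innerB-insertsB : ∀ {x} B → All (_< x) (toList B) →
      Σ innerB (insertsB x B) ≈ (λ′ ⊕ length (toList B) · μ) ⊛ innerB B
    Σ-innerB-insertsB {x} B B<x = begin
      -- The threshold `minB B′` varies with the summand only in appearance; it is replaced by the
      -- fixed `minB B`.
      Σ innerB I                      ≈⟨ Σ-cong I (λ {B′} p → reflexive (cong (λ t → word λ′ μ t (toList B′)) (minB-insertsB B B<x p))) ⟩
      Σ (w ∘ toList) I                ≡⟨ Σ-map w toList I ⟨
      Σ w (map toList I)              ≡⟨ cong (Σ w) (map-toList-insertsB x B) ⟩
      Σ w (inserts x (toList B))      ≈⟨ Σ-word-inserts λ′ μ (minB B) (minB< B B<x) B<x ⟩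
      (λ′ ⊕ length (toList B) · μ) ⊛ innerB B ∎
      where
      I = insertsB x B
      w = word λ′ μ (minB B)

    -- Each block offers one last position, worth `λ′`, and as many others as it has letters, each
    -- worth `μ`; these coefficients add up over the blocks.
    Σ-inner-joins : ∀ {x} π → All (_< x) (letters π) →
      Σ inner (joins x π) ≈ (length π · λ′ ⊕ length (letters π) · μ) ⊛ inner π
    Σ-inner-joins []      _   = ≈-sym (≈-trans (*-congʳ (+-identityʳ 0#)) (zeroˡ _))
    Σ-inner-joins {x} (B ∷ π) π<x = begin
      Σ inner (map (_∷ π) I ++ map (B ∷_) J)
        ≈⟨ Σ-++ inner (map (_∷ π) I) _ ⟩
      Σ inner (map (_∷ π) I) ⊕ Σ inner (map (B ∷_) J)
        ≡⟨ cong₂ _⊕_ (Σ-map inner (_∷ π) I) (Σ-map inner (B ∷_) J) ⟩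
      Σ (λ B′ → inner (B′ ∷ π)) I ⊕ Σ (λ σ → inner (B ∷ σ)) J
        ≈⟨ +-cong (Σ-cong I (λ {B′} _ → inner-∷ B′ π)) (Σ-cong J (λ {σ} _ → inner-∷ B σ)) ⟩
      Σ (λ B′ → innerB B′ ⊛ inner π) I ⊕ Σ (λ σ → innerB B ⊛ inner σ) J
        ≈⟨ +-cong (Σ-*ʳ _ innerB I) (Σ-*ˡ _ inner J) ⟩
      Σ innerB I ⊛ inner π ⊕ innerB B ⊛ Σ inner J
        ≈⟨ +-cong (*-congʳ (Σ-innerB-insertsB B (All.++⁻ˡ (toList B) π<x)))
                  (*-congˡ (Σ-inner-joins π (All.++⁻ʳ (toList B) π<x))) ⟩
      (λ′ ⊕ b · μ) ⊛ innerB B ⊛ inner π ⊕ innerB B ⊛ ((m · λ′ ⊕ n · μ) ⊛ inner π)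
        ≈⟨ +-cong (*-assoc _ _ _) (x∙yz≈y∙xz _ _ _) ⟩
      (λ′ ⊕ b · μ) ⊛ (innerB B ⊛ inner π) ⊕ (m · λ′ ⊕ n · μ) ⊛ (innerB B ⊛ inner π)
        ≈⟨ distribʳ _ _ _ ⟨
      ((λ′ ⊕ b · μ) ⊕ (m · λ′ ⊕ n · μ)) ⊛ (innerB B ⊛ inner π)
        ≈⟨ *-cong (+-interchange _ _ _ _) (≈-sym (inner-∷ B π)) ⟩
      ((λ′ ⊕ m · λ′) ⊕ (b · μ ⊕ n · μ)) ⊛ inner (B ∷ π)
        ≈⟨ *-congʳ (+-congˡ (×-homo-+ μ b n)) ⟨
      (suc m · λ′ ⊕ (b +ℕ n) · μ) ⊛ inner (B ∷ π)
        ≡⟨ cong (λ k → (suc m · λ′ ⊕ k · μ) ⊛ inner (B ∷ π)) (length-++ (toList B)) ⟨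
      (suc m · λ′ ⊕ length (letters (B ∷ π)) · μ) ⊛ inner (B ∷ π) ∎
      where
      I = insertsB x B
      J = joins x π
      b = length (toList B)
      m = length π
      n = length (letters π)

    Σ-weight-joins : ∀ {x} π → All (_< x) (letters π) →
      Σ (weight α β λ′ μ) (joins x π) ≈ (length π · λ′ ⊕ length (letters π) · μ) ⊛ weight α β λ′ μ π
    Σ-weight-joins {x} π π<x = begin
      Σ (weight α β λ′ μ) J
        ≈⟨ Σ-cong J (λ {σ} p → ≈-trans (weight≈ σ) (*-congʳ (reflexive (cong (word α β 1) (map-minB-joins π π<x p))))) ⟩
      Σ (λ σ → outer π ⊛ inner σ) J ≈⟨ Σ-*ˡ (outer π) inner J ⟩
      outer π ⊛ Σ inner J           ≈⟨ *-congˡ (Σ-inner-joins π π<x) ⟩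
      outer π ⊛ (k ⊛ inner π)       ≈⟨ x∙yz≈y∙xz _ _ _ ⟩
      k ⊛ (outer π ⊛ inner π)       ≈⟨ *-congˡ (weight≈ π) ⟨
      k ⊛ weight α β λ′ μ π         ∎
      where
      J = joins x π
      k = length π · λ′ ⊕ length (letters π) · μ

    -- Wherever the guard of `𝕊` returns `0#`, no partition exists. The index is `suc n` because
    -- `LLP 0 0` contains the empty partition, while `𝕊 0 0` is `0#`.
    𝕊≈Σ : ∀ n m → 𝕊 (suc n) m α β λ′ μ ≈ Σ (weight α β λ′ μ) (LLP (suc n) m)
    𝕊≈Σ n zero rewrite LLP-suc-0≡[] n = ≈-refl
    𝕊≈Σ n (suc m) with m ≤? n
    ... | yes m≤n rewrite dec-true (suc m ≤? suc n) (s≤s m≤n) = ≈-refl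
    ... | no  m≰n rewrite dec-false (suc m ≤? suc n) (m≰n ∘ s≤s⁻¹) | m>n⇒LLP≡[] (s≤s (ℕ.≰⇒> m≰n)) = ≈-refl

    𝕊-recurrence : ∀ n m → 𝕊 (suc (suc n)) (suc m) α β λ′ μ ≈
      (α ⊕ m · β) ⊛ 𝕊 (suc n) m α β λ′ μ ⊕ (suc m · λ′ ⊕ suc n · μ) ⊛ 𝕊 (suc n) (suc m) α β λ′ μ
    𝕊-recurrence n m = begin
      𝕊 (suc (suc n)) (suc m) α β λ′ μ
        ≈⟨ 𝕊≈Σ (suc n) (suc m) ⟩
      Σ w (LLP (suc (suc n)) (suc m))
        ≈⟨ Σ-↭ w (LLP-suc-↭ (suc n) m) ⟩
      Σ w (extend (suc n) m)
        ≈⟨ Σ-++ w (concatMap (inserts [x]) L) _ ⟩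
      Σ w (concatMap (inserts [x]) L) ⊕ Σ w (concatMap (joins x) L′)
        ≈⟨ +-cong (Σ-concatMap w (inserts [x]) L) (Σ-concatMap w (joins x) L′) ⟩
      Σ (λ π → Σ w (inserts [x] π)) L ⊕ Σ (λ π → Σ w (joins x π)) L′
        ≈⟨ +-cong (Σ-cong L new-block) (Σ-cong L′ new-letter) ⟩
      Σ (λ π → (α ⊕ m · β) ⊛ w π) L ⊕ Σ (λ π → (suc m · λ′ ⊕ suc n · μ) ⊛ w π) L′
        ≈⟨ +-cong (Σ-*ˡ _ w L) (Σ-*ˡ _ w L′) ⟩
      (α ⊕ m · β) ⊛ Σ w L ⊕ (suc m · λ′ ⊕ suc n · μ) ⊛ Σ w L′
        ≈⟨ +-cong (*-congˡ (𝕊≈Σ n m)) (*-congˡ (𝕊≈Σ n (suc m))) ⟨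
      (α ⊕ m · β) ⊛ 𝕊 (suc n) m α β λ′ μ ⊕ (suc m · λ′ ⊕ suc n · μ) ⊛ 𝕊 (suc n) (suc m) α β λ′ μ ∎
      where
      w = weight α β λ′ μ
      x = suc (suc n)
      [x] : Block
      [x] = x ∷ []
      L = LLP (suc n) m
      L′ = LLP (suc n) (suc m)

      new-block : ∀ {π} → π ∈ L → Σ w (inserts [x] π) ≈ (α ⊕ m · β) ⊛ w π
      -- The new minimum `suc (suc n)` exceeds 1, so in last position it counts towards `rlb`.
      new-block {π} π∈ = ≈-trans (Σ-weight-inserts (s≤s z<s) π (∈-LLP⇒< (suc n) m π∈))
        (reflexive (cong (λ k → (α ⊕ k · β) ⊛ w π) (proj₁ (∈-LLP⁻ (suc n) m π∈))))

      new-letter : ∀ {π} → π ∈ L′ → Σ w (joins x π) ≈ (suc m · λ′ ⊕ suc n · μ) ⊛ w π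
      new-letter {π} π∈ = ≈-trans (Σ-weight-joins π (∈-LLP⇒< (suc n) (suc m) π∈))
        (reflexive (cong₂ (λ k l → (k · λ′ ⊕ l · μ) ⊛ w π)
          (proj₁ (∈-LLP⁻ (suc n) (suc m) π∈)) (length-letters (suc n) (suc m) π∈)))

    𝕊-1-1 : 𝕊 1 1 α β λ′ μ ≈ 1#
    𝕊-1-1 = begin
      -- `LLP 1 1` evaluates to the one partition with block 1, on which all four statistics vanish.
      1# ⊛ 1# ⊛ 1# ⊛ 1# ⊕ 0# ≈⟨ +-identityʳ _ ⟩
      1# ⊛ 1# ⊛ 1# ⊛ 1#      ≈⟨ *-identityʳ _ ⟩
      1# ⊛ 1# ⊛ 1#           ≈⟨ *-identityʳ _ ⟩
      1# ⊛ 1#                ≈⟨ *-identityʳ _ ⟩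
      1#                     ∎

theorem4p2 : ∀ {c ℓ} (R : CommutativeRing c ℓ) →
    let open CommutativeRing R
        open Stirling R in
    (α β λ′ μ : Carrier) →
    (𝕊 1 1 α β λ′ μ ≈ 1#) ×
    (∀ (n m : ℕ) → 2 ≤ n → 1 ≤ m → m ≤ n →
      𝕊 n m α β λ′ μ ≈
        (α + (m ∸ 1) · β) * 𝕊 (n ∸ 1) (m ∸ 1) α β λ′ μ
        + (m · λ′ + (n ∸ 1) · μ) * 𝕊 (n ∸ 1) m α β λ′ μ)
theorem4p2 R α β λ′ μ = 𝕊-1-1 α β λ′ μ , λ where
    -- The bounds `2 ≤ n` and `1 ≤ m` expose successors, so each `∸ 1` computes to a predecessor.
    (suc (suc n)) (suc m) (s≤s (s≤s _)) (s≤s _) _ → 𝕊-recurrence α β λ′ μ n m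
  where open WeightSums R
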